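{- Let $\Omega$ be a Stone signature and let $\mathcal S$ be an arbitrary Stone pseudovariety of $\Omega$-algebras. Let $\varphi:S\to T$ be an onto continuous homomorphism of Stone topological $\Omega$-algebras where $S$ is residually $\mathcal S$. Then $T$ is also residually $\mathcal S$.
   Context: A Stone signature is $\Omega=\biguplus_n\Omega_n$ with each $\Omega_n$ a compact Hausdorff 0-dimensional space. A Stone topological $\Omega$-algebra is a compact Hausdorff 0-dimensional space $A$ with continuous evaluation maps $\Omega_n\times A^n\to A$. A Stone pseudovariety is a nonempty class of Stone topological $\Omega$-algebras closed under images by onto continuous homomorphisms that are Stone topological algebras, closed subalgebras, and finite direct products. An algebra is residually $\mathcal S$ if any two distinct elements are separated by a continuous homomorphism into a member of $\mathcal S$. -}

module Defs where

open import Level using (Level; _⊔_) renaming (suc to lsuc)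
open import Data.Nat using (ℕ)
open import Data.Fin using (Fin)
open import Data.List using (List)
open import Data.List.Relation.Unary.Any using (Any)
open import Data.Product using (Σ; Σ-syntax; _×_; _,_; proj₁; proj₂)
open import Data.Product.Relation.Binary.Pointwise.NonDependent using (×-setoid)
open import Data.Unit.Polymorphic using (⊤; tt)
open import Function using (_∘_)
open import Function.Bundles using (Func)
open import Function.Definitions using (StrictlySurjective)
open import Relation.Binary using (Setoid; _Respects_)
import Relation.Binary.Construct.On as On
open import Relation.Nullary using (¬_)
open import Relation.Unary using (Pred; _∈_; _⊆_; _≐_; _∩_; _⊢_; ∁; ⋃; Satisfiable; Universal)

-- Sets are setoids, so that quotients are available.  Subsets are predicates
-- into Set ℓ; the open ones are required to respect the setoid equality.
-- Unions and covers are indexed by types in Set ℓ.  In the presence of excluded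
-- middle this is no restriction: every subset of the carrier is then given by a
-- map Carrier → Bool, and these form a type in Set ℓ.

record TopologicalSpace (ℓ : Level) : Set (lsuc (lsuc ℓ)) where
  field
    setoid : Setoid ℓ ℓ
  open Setoid setoid public
  field
    Open          : Pred Carrier ℓ → Set (lsuc ℓ)
    open-respects : ∀ {U} → Open U → U Respects _≈_
    open-≐        : ∀ {U V} → U ≐ V → Open U → Open V
    open-⊤        : Open (λ _ → ⊤)
    open-∩        : ∀ {U V} → Open U → Open V → Open (U ∩ V)
    open-⋃        : (I : Set ℓ) (U : I → Pred Carrier ℓ) → (∀ i → Open (U i)) → Open (⋃ I U)

  Closed : Pred Carrier ℓ → Set (lsuc ℓ)
  Closed C = C Respects _≈_ × Open (∁ C)

  Clopen : Pred Carrier ℓ → Set (lsuc ℓ)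
  Clopen K = Open K × Closed K

  Compact : Set (lsuc ℓ)
  Compact = (I : Set ℓ) (U : I → Pred Carrier ℓ) → (∀ i → Open (U i)) → Universal (⋃ I U) →
            Σ[ is ∈ List I ] (∀ x → Any (λ i → x ∈ U i) is)

  Hausdorff : Set (lsuc ℓ)
  Hausdorff = ∀ {x y} → ¬ (x ≈ y) →
              Σ[ U ∈ Pred Carrier ℓ ] Σ[ V ∈ Pred Carrier ℓ ]
                Open U × Open V × x ∈ U × y ∈ V × (∀ z → ¬ (z ∈ U × z ∈ V))

  -- The clopen sets form a base of the topology.
  ZeroDimensional : Set (lsuc ℓ)
  ZeroDimensional = ∀ {U} → Open U → ∀ {x} → x ∈ U →
                    Σ[ K ∈ Pred Carrier ℓ ] Clopen K × x ∈ K × K ⊆ U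

  record IsStone : Set (lsuc ℓ) where
    field
      compact         : Compact
      hausdorff       : Hausdorff
      zeroDimensional : ZeroDimensional

open TopologicalSpace using (Open; IsStone) renaming (Carrier to ∣_∣)

private variable
  ℓ p : Level

record ContinuousMap (X Y : TopologicalSpace ℓ) : Set (lsuc ℓ) where
  private
    module X = TopologicalSpace X
    module Y = TopologicalSpace Y
  field
    func       : Func X.setoid Y.setoid
    continuous : ∀ {V} → Y.Open V → X.Open (Func.to func ⊢ V)
  open Func func public using (to; cong)

module _ (S : Setoid ℓ ℓ) where
  private
    module S = Setoid S

  -- The smallest topology containing a given family of subsets.
  data Generated (B : Pred S.Carrier ℓ → Set (lsuc ℓ)) : Pred S.Carrier ℓ → Set (lsuc ℓ) where
    basic : ∀ {U} → B U → Generated B U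
    ext   : ∀ {U V} → U ≐ V → Generated B U → Generated B V
    whole : Generated B (λ _ → ⊤)
    inter : ∀ {U V} → Generated B U → Generated B V → Generated B (U ∩ V)
    union : (I : Set ℓ) (U : I → Pred S.Carrier ℓ) → (∀ i → Generated B (U i)) → Generated B (⋃ I U)

  generate : (B : Pred S.Carrier ℓ → Set (lsuc ℓ)) →
             (∀ {U} → B U → U Respects S._≈_) → TopologicalSpace ℓ
  generate B B-respects = record
    { setoid        = S
    ; Open          = Generated B
    ; open-respects = respects
    ; open-≐        = ext
    ; open-⊤        = whole
    ; open-∩        = inter
    ; open-⋃        = union
    }
    where
    respects : ∀ {U} → Generated B U → U Respects S._≈_
    respects (basic b)             x≈y u       = B-respects b x≈y u
    respects (ext (U⊆V , V⊆U) g)   x≈y v       = U⊆V (respects g x≈y (V⊆U v))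
    respects whole                 x≈y _       = tt
    respects (inter g h)           x≈y (u , v) = respects g x≈y u , respects h x≈y v
    respects (union I U g)         x≈y (i , u) = i , respects (g i) x≈y u

module _ (X Y : TopologicalSpace ℓ) where
  private
    module X = TopologicalSpace X
    module Y = TopologicalSpace Y

  data ×-Subbasis : Pred (X.Carrier × Y.Carrier) ℓ → Set (lsuc ℓ) where
    left  : ∀ {U} → X.Open U → ×-Subbasis (proj₁ ⊢ U)
    right : ∀ {V} → Y.Open V → ×-Subbasis (proj₂ ⊢ V)

  infixr 2 _×ₜ_
  _×ₜ_ : TopologicalSpace ℓ
  _×ₜ_ = generate (×-setoid X.setoid Y.setoid) ×-Subbasis respects
    where
    respects : ∀ {U} → ×-Subbasis U → U Respects Setoid._≈_ (×-setoid X.setoid Y.setoid)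
    respects (left o)  (x≈ , _) = X.open-respects o x≈
    respects (right o) (_ , y≈) = Y.open-respects o y≈

module _ {n : ℕ} (X : Fin n → TopologicalSpace ℓ) where
  private
    module X i = TopologicalSpace (X i)

  ∏-setoid : Setoid ℓ ℓ
  ∏-setoid = record
    { Carrier       = ∀ i → X.Carrier i
    ; _≈_           = λ x y → ∀ i → X._≈_ i (x i) (y i)
    ; isEquivalence = record
      { refl  = λ i → X.refl i
      ; sym   = λ x≈y i → X.sym i (x≈y i)
      ; trans = λ x≈y y≈z i → X.trans i (x≈y i) (y≈z i)
      }
    }

  data ∏-Subbasis : Pred (∀ i → X.Carrier i) ℓ → Set (lsuc ℓ) where
    cylinder : ∀ i {V} → X.Open i V → ∏-Subbasis ((λ x → x i) ⊢ V)

  ∏ₜ : TopologicalSpace ℓ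
  ∏ₜ = generate ∏-setoid ∏-Subbasis respects
    where
    respects : ∀ {U} → ∏-Subbasis U → U Respects Setoid._≈_ ∏-setoid
    respects (cylinder i o) x≈y = X.open-respects i o (x≈y i)

_^ₜ_ : TopologicalSpace ℓ → ℕ → TopologicalSpace ℓ
X ^ₜ n = ∏ₜ {n = n} (λ _ → X)

module _ (X : TopologicalSpace ℓ) where
  private
    module X = TopologicalSpace X

  subspace : Pred X.Carrier ℓ → TopologicalSpace ℓ
  subspace C = record
    { setoid        = On.setoid {B = Σ X.Carrier C} X.setoid proj₁
    ; Open          = λ U → Σ[ V ∈ Pred X.Carrier ℓ ] X.Open V × (proj₁ ⊢ V) ≐ U
    ; open-respects = λ { (V , o , V⊆U , U⊆V) x≈y u → V⊆U (X.open-respects o x≈y (U⊆V u)) }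
    ; open-≐        = λ { (U⊆U′ , U′⊆U) (V , o , V⊆U , U⊆V) →
                          V , o , (λ v → U⊆U′ (V⊆U v)) , (λ u → U⊆V (U′⊆U u)) }
    ; open-⊤        = (λ _ → ⊤) , X.open-⊤ , (λ _ → tt) , (λ _ → tt)
    ; open-∩        = λ { (V , o , V⊆U , U⊆V) (V′ , o′ , V′⊆U′ , U′⊆V′) →
                          V ∩ V′ , X.open-∩ o o′
                          , (λ (v , v′) → V⊆U v , V′⊆U′ v′)
                          , (λ (u , u′) → U⊆V u , U′⊆V′ u′) }
    ; open-⋃        = λ I U os →
                          ⋃ I (λ i → proj₁ (os i)) , X.open-⋃ I _ (λ i → proj₁ (proj₂ (os i)))
                          , (λ (i , v) → i , proj₁ (proj₂ (proj₂ (os i))) v)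
                          , (λ (i , u) → i , proj₂ (proj₂ (proj₂ (os i))) u)
    }

record StoneSignature (ℓ : Level) : Set (lsuc (lsuc ℓ)) where
  field
    Op       : ℕ → TopologicalSpace ℓ
    Op-stone : ∀ n → IsStone (Op n)

module _ (Ω : StoneSignature ℓ) where
  open StoneSignature Ω

  record TopologicalAlgebra : Set (lsuc (lsuc ℓ)) where
    field
      space : TopologicalSpace ℓ
      eval  : ∀ n → ContinuousMap (Op n ×ₜ (space ^ₜ n)) space
    open TopologicalSpace space public

    ⟦_⟧ : ∀ {n} → ∣ Op n ∣ → (Fin n → Carrier) → Carrier
    ⟦_⟧ {n} ω xs = ContinuousMap.to (eval n) (ω , xs)

module _ {Ω : StoneSignature ℓ} where
  open StoneSignature Ω

  record ContinuousHom (A B : TopologicalAlgebra Ω) : Set (lsuc ℓ) where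
    private
      module A = TopologicalAlgebra A
      module B = TopologicalAlgebra B
    field
      map : ContinuousMap A.space B.space
    open ContinuousMap map public
    field
      homo : ∀ {n} (ω : ∣ Op n ∣) (xs : Fin n → A.Carrier) →
             to (A.⟦ ω ⟧ xs) B.≈ B.⟦ ω ⟧ (to ∘ xs)

    Onto : Set ℓ
    Onto = StrictlySurjective B._≈_ to

  module _ (A : TopologicalAlgebra Ω) where
    private
      module A = TopologicalAlgebra A

    record IsClosedSubalgebra (C : Pred A.Carrier ℓ) : Set (lsuc ℓ) where
      field
        closed      : A.Closed C
        closed-eval : ∀ {n} (ω : ∣ Op n ∣) {xs : Fin n → A.Carrier} →
                      (∀ i → xs i ∈ C) → A.⟦ ω ⟧ xs ∈ C

    subalgebra : (C : Pred A.Carrier ℓ) → IsClosedSubalgebra C → TopologicalAlgebra Ω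
    subalgebra C sub = record { space = X ; eval = ev }
      where
      open IsClosedSubalgebra sub
      X = subspace A.space C

      include : ∀ n → ∣ Op n ∣ × (Fin n → ∣ X ∣) → ∣ Op n ∣ × (Fin n → A.Carrier)
      include n (ω , xs) = ω , proj₁ ∘ xs

      include-power : ∀ n {W} → (A.space ^ₜ n) .Open W →
                      (Op n ×ₜ (X ^ₜ n)) .Open (λ z → W (proj₂ (include n z)))
      include-power n (basic (cylinder i {V} o)) =
        basic (right (basic (cylinder i (V , o , (λ v → v) , (λ v → v)))))
      include-power n (ext (f , g) o) = ext (f , g) (include-power n o)
      include-power n whole           = whole
      include-power n (inter o o′)    = inter (include-power n o) (include-power n o′)
      include-power n (union I U os)  = union I _ (λ i → include-power n (os i))

      include-continuous : ∀ n {W} → (Op n ×ₜ (A.space ^ₜ n)) .Open W →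
                           (Op n ×ₜ (X ^ₜ n)) .Open (include n ⊢ W)
      include-continuous n (basic (left o))  = basic (left o)
      include-continuous n (basic (right o)) = include-power n o
      include-continuous n (ext (f , g) o)   = ext (f , g) (include-continuous n o)
      include-continuous n whole             = whole
      include-continuous n (inter o o′)      =
        inter (include-continuous n o) (include-continuous n o′)
      include-continuous n (union I U os)    = union I _ (λ i → include-continuous n (os i))

      ev : ∀ n → ContinuousMap (Op n ×ₜ (X ^ₜ n)) X
      ev n = record
        { func = record
          { to   = λ (ω , xs) → A.⟦ ω ⟧ (proj₁ ∘ xs) , closed-eval ω (λ i → proj₂ (xs i))
          ; cong = λ (ω≈ , xs≈) → ContinuousMap.cong (A.eval n) (ω≈ , xs≈)
          }
        ; continuous = λ (V , o , f , g) →
            ext (f , g) (include-continuous n (ContinuousMap.continuous (A.eval n) o))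
        }

  module _ {m : ℕ} (A : Fin m → TopologicalAlgebra Ω) where
    private
      module A i = TopologicalAlgebra (A i)

    ∏ₐ : TopologicalAlgebra Ω
    ∏ₐ = record { space = X ; eval = ev }
      where
      X = ∏ₜ A.space

      project : ∀ n i → ∣ Op n ∣ × (Fin n → ∣ X ∣) → ∣ Op n ∣ × (Fin n → A.Carrier i)
      project n i (ω , xs) = ω , λ k → xs k i

      project-power : ∀ n i {W} → (A.space i ^ₜ n) .Open W →
                      (Op n ×ₜ (X ^ₜ n)) .Open (λ z → W (proj₂ (project n i z)))
      project-power n i (basic (cylinder k o)) =
        basic (right (basic (cylinder k (basic (cylinder i o)))))
      project-power n i (ext (f , g) o) = ext (f , g) (project-power n i o)
      project-power n i whole           = whole
      project-power n i (inter o o′)    = inter (project-power n i o) (project-power n i o′)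
      project-power n i (union I U os)  = union I _ (λ j → project-power n i (os j))

      project-continuous : ∀ n i {W} → (Op n ×ₜ (A.space i ^ₜ n)) .Open W →
                           (Op n ×ₜ (X ^ₜ n)) .Open (project n i ⊢ W)
      project-continuous n i (basic (left o))  = basic (left o)
      project-continuous n i (basic (right o)) = project-power n i o
      project-continuous n i (ext (f , g) o)   = ext (f , g) (project-continuous n i o)
      project-continuous n i whole             = whole
      project-continuous n i (inter o o′)      =
        inter (project-continuous n i o) (project-continuous n i o′)
      project-continuous n i (union I U os)    = union I _ (λ j → project-continuous n i (os j))

      evaluate : ∀ n → ∣ Op n ∣ × (Fin n → ∣ X ∣) → ∣ X ∣
      evaluate n (ω , xs) i = A.⟦_⟧ i ω (λ k → xs k i)

      evaluate-continuous : ∀ n {W} → X .Open W → (Op n ×ₜ (X ^ₜ n)) .Open (evaluate n ⊢ W)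
      evaluate-continuous n (basic (cylinder i o)) =
        project-continuous n i (ContinuousMap.continuous (A.eval i n) o)
      evaluate-continuous n (ext (f , g) o) = ext (f , g) (evaluate-continuous n o)
      evaluate-continuous n whole           = whole
      evaluate-continuous n (inter o o′)    =
        inter (evaluate-continuous n o) (evaluate-continuous n o′)
      evaluate-continuous n (union I U os)  = union I _ (λ j → evaluate-continuous n (os j))

      ev : ∀ n → ContinuousMap (Op n ×ₜ (X ^ₜ n)) X
      ev n = record
        { func = record
          { to   = evaluate n
          ; cong = λ (ω≈ , xs≈) i → ContinuousMap.cong (A.eval i n) (ω≈ , λ k → xs≈ k i)
          }
        ; continuous = evaluate-continuous n
        }

  IsStoneAlgebra : TopologicalAlgebra Ω → Set (lsuc ℓ)
  IsStoneAlgebra A = IsStone (TopologicalAlgebra.space A)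

  record IsStonePseudovariety (𝒮 : Pred (TopologicalAlgebra Ω) p) : Set (lsuc (lsuc ℓ) ⊔ p) where
    field
      stone        : 𝒮 ⊆ IsStoneAlgebra
      nonempty     : Satisfiable 𝒮
      images       : ∀ {A B} → A ∈ 𝒮 → IsStoneAlgebra B →
                     (f : ContinuousHom A B) → ContinuousHom.Onto f → B ∈ 𝒮
      subalgebras  : ∀ {A} → A ∈ 𝒮 → ∀ C (sub : IsClosedSubalgebra A C) → subalgebra A C sub ∈ 𝒮
      products     : ∀ {m} (A : Fin m → TopologicalAlgebra Ω) → (∀ i → A i ∈ 𝒮) → ∏ₐ A ∈ 𝒮

  Residually : Pred (TopologicalAlgebra Ω) p → TopologicalAlgebra Ω → Set (lsuc (lsuc ℓ) ⊔ p)
  Residually 𝒮 A = ∀ {x y} → ¬ (x A.≈ y) →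
    Σ[ B ∈ TopologicalAlgebra Ω ] B ∈ 𝒮 × Σ[ f ∈ ContinuousHom A B ]
      ¬ TopologicalAlgebra._≈_ B (ContinuousHom.to f x) (ContinuousHom.to f y)
    where module A = TopologicalAlgebra A

{-# OPTIONS --safe #-}

-- Distinct points of T are separated by a clopen set K.  Let ~ be the syntactic congruence of K,
-- x ~ y iff every unary polynomial maps both or neither of x, y into K.  The preimages of K under
-- polynomials are ~-saturated clopen sets separating the classes, so T/~ is a Stone algebra, even
-- though ~ need not be open.  By compactness the clopen set φ⁻¹K is recognised by a continuous
-- homomorphism f from S to a finite product F of members of 𝒮; lifting polynomials along φ shows
-- that f s ≈ f s′ implies φ s ~ φ s′.  Hence T/~ is a continuous image of the closed subalgebra
-- f(S) of F and so lies in 𝒮.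

module Submission where

open import Defs
open import Axiom.ExcludedMiddle using (ExcludedMiddle)
open import Axiom.DoubleNegationElimination using (em⇒dne)
open import Data.Fin using (Fin; zero; suc; _≟_)
open import Data.List using (List; []; _∷_; _++_; lookup; allFin)
open import Data.List.Membership.Propositional renaming (_∈_ to _∈ₗ_; _∉_ to _∉ₗ_) using ()
open import Data.List.Membership.Propositional.Properties using (∈-allFin)
open import Data.List.Relation.Unary.Any using (Any; here; there)
import Data.List.Relation.Unary.Any as Any
open import Data.List.Relation.Unary.Any.Properties using (++⁺ˡ; ++⁺ʳ; lookup-result)
open import Data.Nat using (ℕ; zero; suc)
open import Data.Product using (Σ; Σ-syntax; _×_; _,_; proj₁; proj₂)
open import Data.Sum using (inj₁; inj₂; [_,_])
open import Data.Unit.Polymorphic using (⊤; tt)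
open import Data.Vec.Functional using (updateAt)
open import Data.Vec.Functional.Properties using (updateAt-updates; updateAt-minimal)
open import Function using (_∘_; const; id; _⇔_; mk⇔; Equivalence)
open import Function.Properties.Equivalence using (⇔-isEquivalence)
open import Level using (Level) renaming (suc to lsuc)
open import Relation.Binary using (Rel; REL; Setoid; IsEquivalence; _⇒_; _Respects_)
open import Relation.Binary.PropositionalEquality using (_≡_; _≢_; refl; sym; subst; subst₂)
open import Relation.Nullary using (¬_; yes; no; contradiction)
open import Relation.Unary using (Pred; _∈_; _∉_; _⊆_; _∩_; _∪_; _⊢_; ∁; Empty)

open TopologicalSpace using (Open; IsStone) renaming (Carrier to ∣_∣)

private variable
  a b ℓ p r : Level
  n : ℕ

-- Replacing one entry of a finite tuple.

_[_≔_] : {A : Set a} → (Fin n → A) → Fin n → A → Fin n → A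
xs [ i ≔ x ] = updateAt xs i (const x)

module _ {A : Set a} where

  ≔-elim : (P : Fin n → A → Set p) {xs : Fin n → A} {i : Fin n} {x : A} →
           P i x → (∀ j → j ≢ i → P j (xs j)) → ∀ j → P j ((xs [ i ≔ x ]) j)
  ≔-elim P {xs} {i} Pix Pxs j with j ≟ i
  ... | yes refl = subst (P j) (sym (updateAt-updates j xs)) Pix
  ... | no j≢i   = subst (P j) (sym (updateAt-minimal j i xs j≢i)) (Pxs j j≢i)

  ≔-pointwise : {B : Set b} (_R_ : REL A B r) {xs : Fin n → A} {ys : Fin n → B}
                {i : Fin n} {x : A} {y : B} →
                x R y → (∀ j → j ≢ i → xs j R ys j) → ∀ j → (xs [ i ≔ x ]) j R (ys [ i ≔ y ]) j
  ≔-pointwise _R_ {xs} {ys} {i} xRy xsRys j with j ≟ i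
  ... | yes refl = subst₂ _R_ (sym (updateAt-updates j xs)) (sym (updateAt-updates j ys)) xRy
  ... | no j≢i   = subst₂ _R_ (sym (updateAt-minimal j i xs j≢i)) (sym (updateAt-minimal j i ys j≢i))
                     (xsRys j j≢i)

-- Open sets, compactness and separation.

module _ (X : TopologicalSpace ℓ) where
  open TopologicalSpace X hiding (Open; IsStone)
  private module X = TopologicalSpace X

  open-locally : ∀ {U} → (∀ {x} → x ∈ U → Σ[ V ∈ Pred Carrier ℓ ] X.Open V × x ∈ V × V ⊆ U) →
                 X.Open U
  open-locally {U} nbhd = open-≐
    ( (λ ((_ , u) , v) → proj₂ (proj₂ (proj₂ (nbhd u))) v)
    , (λ u → (_ , u) , proj₁ (proj₂ (proj₂ (nbhd u)))) )
    (open-⋃ (Σ Carrier U) _ (λ (_ , u) → proj₁ (proj₂ (nbhd u))))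

  -- The set is the union of copies of the whole space indexed by the proofs of `P`.
  open-const : (P : Set ℓ) → X.Open (λ _ → P)
  open-const P = open-≐ (proj₁ , (_, tt)) (open-⋃ P (λ _ _ → ⊤) (λ _ → open-⊤))

  open-⋂ : ∀ {m} {V : Fin m → Pred Carrier ℓ} → (∀ i → X.Open (V i)) → X.Open (λ x → ∀ i → x ∈ V i)
  open-⋂ {zero}  os = open-≐ ((λ _ ()) , (λ _ → tt)) open-⊤
  open-⋂ {suc m} os = open-≐
    ((λ { (v , vs) zero → v ; (v , vs) (suc i) → vs i }) , (λ vs → vs zero , vs ∘ suc))
    (open-∩ (os zero) (open-⋂ (os ∘ suc)))

  clopen-⊤ : Clopen (λ _ → ⊤)
  clopen-⊤ = open-⊤ , (λ _ _ → tt) , open-locally (λ ¬tt → contradiction tt ¬tt)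

  -- A property that passes to subsets and finite unions and holds locally holds globally.
  compact-induction : Compact → (P : Pred (Pred Carrier ℓ) p) →
    (∀ {U} → Empty U → P U) → (∀ {U V} → P U → P V → P (U ∪ V)) → (∀ {U V} → U ⊆ V → P V → P U) →
    (∀ x → Σ[ U ∈ Pred Carrier ℓ ] X.Open U × x ∈ U × P U) → P (λ _ → ⊤)
  compact-induction compact P P-∅ P-∪ P-⊆ local = P-⊆ (λ {x} _ → proj₂ cover x) (finite (proj₁ cover))
    where
    cover : Σ[ is ∈ List Carrier ] (∀ x → Any (λ i → x ∈ proj₁ (local i)) is)
    cover = compact Carrier (proj₁ ∘ local) (proj₁ ∘ proj₂ ∘ local)
              (λ x → x , proj₁ (proj₂ (proj₂ (local x))))

    finite : ∀ is → P (λ x → Any (λ i → x ∈ proj₁ (local i)) is)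
    finite []       = P-∅ (λ _ ())
    finite (i ∷ is) = P-⊆ (λ { (here u) → inj₁ u ; (there v) → inj₂ v })
                        (P-∪ (proj₂ (proj₂ (proj₂ (local i)))) (finite is))

  TotallySeparated : Set (lsuc ℓ)
  TotallySeparated = ∀ {x y} → ¬ (x ≈ y) → Σ[ M ∈ Pred Carrier ℓ ] Clopen M × x ∈ M × y ∉ M

-- Preimages commute with finite intersections and arbitrary unions, so continuity need only be
-- checked on the generating sets.
generated-preimage : (X : TopologicalSpace ℓ) (S : Setoid ℓ ℓ)
  {B : Pred (Setoid.Carrier S) ℓ → Set (lsuc ℓ)} (f : ∣ X ∣ → Setoid.Carrier S) →
  (∀ {U} → B U → X .Open (f ⊢ U)) → ∀ {U} → Generated S B U → X .Open (f ⊢ U)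
generated-preimage X S f B-open = go
  where
  open TopologicalSpace X using (open-≐; open-⊤; open-∩; open-⋃)

  go : ∀ {U} → Generated S _ U → X .Open (f ⊢ U)
  go (basic b)             = B-open b
  go (ext (U⊆V , V⊆U) o)   = open-≐ ((λ u → U⊆V u) , (λ v → V⊆U v)) (go o)
  go whole                 = open-⊤
  go (inter o o′)          = open-∩ (go o) (go o′)
  go (union I U os)        = open-⋃ I _ (λ i → go (os i))

-- Quotient spaces

module Quotient (X : TopologicalSpace ℓ) (_~_ : Rel ∣ X ∣ ℓ) (~-isEquivalence : IsEquivalence _~_)
                (≈⇒~ : TopologicalSpace._≈_ X ⇒ _~_) where
  private module X = TopologicalSpace X

  -- The carrier is kept and only its equality is coarsened, so the open sets of the quotient
  -- topology are the saturated open sets of `X` and the projection is the identity.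
  space : TopologicalSpace ℓ
  space = record
    { setoid        = record { isEquivalence = ~-isEquivalence }
    ; Open          = λ U → U Respects _~_ × X.Open U
    ; open-respects = proj₁
    ; open-≐        = λ (U⊆V , V⊆U) (resp , o) →
                        (λ x~y v → U⊆V (resp x~y (V⊆U v))) , X.open-≐ (U⊆V , V⊆U) o
    ; open-⊤        = (λ _ _ → tt) , X.open-⊤
    ; open-∩        = λ (resp , o) (resp′ , o′) →
                        (λ x~y (u , v) → resp x~y u , resp′ x~y v) , X.open-∩ o o′
    ; open-⋃        = λ I U os →
                        (λ x~y (i , u) → i , proj₁ (os i) x~y u) , X.open-⋃ I U (proj₂ ∘ os)
    }

  projection : ContinuousMap X space
  projection = record { func = record { to = id ; cong = ≈⇒~ } ; continuous = proj₂ }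

  compact : X.Compact → TopologicalSpace.Compact space
  compact c I U os = c I U (proj₂ ∘ os)

-- Basic open boxes in the product of a space with a finite power.

record Box (Z X : TopologicalSpace ℓ) {n : ℕ} (z : ∣ Z ∣) (xs : Fin n → ∣ X ∣) : Set (lsuc ℓ) where
  field
    base      : Pred ∣ Z ∣ ℓ
    side      : Fin n → Pred ∣ X ∣ ℓ
    base-open : Z .Open base
    side-open : ∀ i → X .Open (side i)
    z∈base    : z ∈ base
    xs∈side   : ∀ i → xs i ∈ side i

  Inside : Pred (∣ Z ∣ × (Fin n → ∣ X ∣)) ℓ
  Inside (w , ys) = w ∈ base × (∀ i → ys i ∈ side i)

module _ {Z X : TopologicalSpace ℓ} {n : ℕ} where
  open Box
  private
    module Z = TopologicalSpace Z
    module X = TopologicalSpace X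

  module _ {z : ∣ Z ∣} {xs : Fin n → ∣ X ∣} where

    box-⊤ : Box Z X z xs
    box-⊤ = record
      { base      = λ _ → ⊤
      ; side      = λ _ _ → ⊤
      ; base-open = Z.open-⊤
      ; side-open = λ _ → X.open-⊤
      ; z∈base    = tt
      ; xs∈side   = λ _ → tt
      }

    box-∩ : Box Z X z xs → Box Z X z xs → Box Z X z xs
    box-∩ C D = record
      { base      = base C ∩ base D
      ; side      = λ i → side C i ∩ side D i
      ; base-open = Z.open-∩ (base-open C) (base-open D)
      ; side-open = λ i → X.open-∩ (side-open C i) (side-open D i)
      ; z∈base    = z∈base C , z∈base D
      ; xs∈side   = λ i → xs∈side C i , xs∈side D i
      }

    inside-open : (C : Box Z X z xs) → (Z ×ₜ (X ^ₜ n)) .Open (Inside C)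
    inside-open C = inter (basic (left (base-open C)))
      (basic (right (TopologicalSpace.open-≐ (X ^ₜ n) ((λ v → v) , (λ v → v))
        (open-⋂ (X ^ₜ n) (λ i → basic (cylinder i (side-open C i)))))))

-- Stone spaces and closed maps, with excluded middle.

module Classical (em : ∀ {a} → ExcludedMiddle a) where

  dne : {P : Set a} → ¬ ¬ P → P
  dne = em⇒dne em

  module _ (X : TopologicalSpace ℓ) where
    open TopologicalSpace X hiding (Open; IsStone)
    private module X = TopologicalSpace X

    open-→ : (P : Set) {V : Pred Carrier ℓ} → X.Open V → X.Open (λ x → P → x ∈ V)
    open-→ P o with em {P = P}
    ... | yes p = open-≐ ((λ v _ → v) , (λ v → v p)) o
    ... | no ¬p = open-≐ ((λ _ p → contradiction p ¬p) , (λ _ → tt)) open-⊤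

    clopen-∁ : ∀ {K} → Clopen K → Clopen (∁ K)
    clopen-∁ (o , _ , o′) = o′ , open-respects o′ , open-≐ ((λ k ¬k → ¬k k) , dne) o

    clopen-∩ : ∀ {K M} → Clopen K → Clopen M → Clopen (K ∩ M)
    clopen-∩ {K} {M} (o , _ , o′) (q , _ , q′) = open-∩ o q , open-respects (open-∩ o q) ,
      open-locally X complement
      where
      complement : ∀ {x} → x ∈ ∁ (K ∩ M) →
                   Σ[ V ∈ Pred Carrier ℓ ] X.Open V × x ∈ V × V ⊆ ∁ (K ∩ M)
      complement {x} ¬km with em {P = x ∈ K}
      ... | yes k = ∁ M , q′ , (λ m → ¬km (k , m)) , (λ ¬m (_ , m) → ¬m m)
      ... | no ¬k = ∁ K , o′ , ¬k , (λ ¬k (k , _) → ¬k k)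

    -- A separating clopen set and its complement give the Hausdorff property. For a base of clopen
    -- sets, induct over `N` on the existence of a clopen `M` around `x` with `M ∩ N` inside `U`: a
    -- point outside `U` is separated from `x`, and finitely many such `M` are intersected.
    totallySeparated⇒stone : Compact → TotallySeparated X → X.IsStone
    totallySeparated⇒stone compact separate = record
      { compact         = compact
      ; hausdorff       = λ x≉y → let M , (o , _ , o′) , x∈M , y∉M = separate x≉y in
                            M , ∁ M , o , o′ , x∈M , y∉M , (λ _ (m , ¬m) → ¬m m)
      ; zeroDimensional = zeroDim
      }
      where
      zeroDim : ZeroDimensional
      zeroDim {U} U-open {x} x∈U =
        let M , clopen , x∈M , M⊆U = compact-induction X compact P
              (λ empty → _ , clopen-⊤ X , tt , (λ _ n → contradiction n (empty _)))
              (λ (M , c , x∈M , f) (M′ , c′ , x∈M′ , f′) → M ∩ M′ , clopen-∩ c c′ , (x∈M , x∈M′) ,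
                 (λ (m , m′) → [ f m , f′ m′ ]))
              (λ N⊆N′ (M , c , x∈M , f) → M , c , x∈M , (λ m n → f m (N⊆N′ n)))
              local
        in M , clopen , x∈M , (λ m → M⊆U m tt)
        where
        P : Pred (Pred Carrier ℓ) (lsuc ℓ)
        P N = Σ[ M ∈ Pred Carrier ℓ ] Clopen M × x ∈ M × (∀ {y} → y ∈ M → y ∈ N → y ∈ U)

        local : ∀ y → Σ[ N ∈ Pred Carrier ℓ ] X.Open N × y ∈ N × P N
        local y with em {P = y ∈ U}
        ... | yes y∈U = U , U-open , y∈U , _ , clopen-⊤ X , tt , (λ _ u → u)
        ... | no y∉U  =
          let M , c , x∈M , y∉M = separate (λ x≈y → y∉U (open-respects U-open x≈y x∈U)) in
          ∁ M , proj₂ (proj₂ c) , y∉M , M , c , x∈M , (λ m ¬m → contradiction m ¬m)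

  module _ {X Y : TopologicalSpace ℓ} (f : ContinuousMap X Y) where
    open ContinuousMap f
    private
      module X = TopologicalSpace X
      module Y = TopologicalSpace Y

    Image : Pred ∣ X ∣ ℓ → Pred ∣ Y ∣ ℓ
    Image D y = Σ[ x ∈ ∣ X ∣ ] x ∈ D × to x Y.≈ y

    -- For `y` outside the image, induct over `N` on the existence of an open `V` around `y` that
    -- misses the image of `N ∩ D`. Near a point of `D`, disjoint neighbourhoods of its image and of
    -- `y` provide `V`.
    image-closed : X.Compact → Y.Hausdorff → ∀ {D} → X.Open (∁ D) → Y.Closed (Image D)
    image-closed compact hausdorff {D} D-closed =
      (λ y≈y′ (x , d , fx≈y) → x , d , Y.trans fx≈y y≈y′) , open-locally Y complement
      where
      module _ {y : ∣ Y ∣} (y∉fD : y ∉ Image D) where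

        P : Pred (Pred ∣ X ∣ ℓ) (lsuc ℓ)
        P N = Σ[ V ∈ Pred ∣ Y ∣ ℓ ] Y.Open V × y ∈ V × (∀ {x} → x ∈ N → x ∈ D → to x ∉ V)

        local : ∀ x → Σ[ N ∈ Pred ∣ X ∣ ℓ ] X.Open N × x ∈ N × P N
        local x with em {P = x ∈ D}
        ... | no x∉D  = ∁ D , D-closed , x∉D , _ , Y.open-⊤ , tt , (λ ¬d d _ → ¬d d)
        ... | yes x∈D =
          let U , V , oU , oV , fx∈U , y∈V , disjoint = hausdorff (λ fx≈y → y∉fD (x , x∈D , fx≈y)) in
          to ⊢ U , continuous oU , fx∈U , V , oV , y∈V , (λ u _ v → disjoint _ (u , v))

        complement : Σ[ V ∈ Pred ∣ Y ∣ ℓ ] Y.Open V × y ∈ V × V ⊆ ∁ (Image D)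
        complement =
          let V , oV , y∈V , avoid = compact-induction X compact P
                (λ empty → _ , Y.open-⊤ , tt , (λ n → contradiction n (empty _)))
                (λ (V , o , y∈V , g) (V′ , o′ , y∈V′ , g′) → V ∩ V′ , Y.open-∩ o o′ , (y∈V , y∈V′) ,
                   (λ n d (v , v′) → [ (λ u → g u d v) , (λ u → g′ u d v′) ] n))
                (λ N⊆N′ (V , o , y∈V , g) → V , o , y∈V , (λ n → g (N⊆N′ n)))
                local
          in V , oV , y∈V , (λ v (x , d , fx≈z) → avoid tt d (Y.open-respects oV (Y.sym fx≈z) v))

  -- Box neighbourhoods and saturated open sets.

  module _ (Z X : TopologicalSpace ℓ) {n : ℕ} where
    open Box
    private
      module Z = TopologicalSpace Z
      module X = TopologicalSpace X

    BoxNeighbourhood : Pred (∣ Z ∣ × (Fin n → ∣ X ∣)) ℓ → ∣ Z ∣ → (Fin n → ∣ X ∣) → Set (lsuc ℓ)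
    BoxNeighbourhood W z xs = Σ[ C ∈ Box Z X z xs ] Inside C ⊆ W

    box-cylinder : ∀ {z} {xs : Fin n → ∣ X ∣} i {V} → X.Open V → xs i ∈ V → Box Z X z xs
    box-cylinder {z} {xs} i {V} o v = record (box-⊤ {Z = Z} {X = X} {z = z} {xs = xs})
      -- Guarding the condition by `j ≡ i` leaves all other coordinates unconstrained.
      { side      = λ j x → j ≡ i → x ∈ V
      ; side-open = λ j → open-→ X (j ≡ i) o
      ; xs∈side   = λ { _ refl → v }
      }

    power-box : ∀ {z xs W} → (X ^ₜ n) .Open W → xs ∈ W → BoxNeighbourhood (proj₂ ⊢ W) z xs
    power-box (basic (cylinder i o)) v       = box-cylinder i o v , (λ (_ , vs) → vs i refl)
    power-box (ext (U⊆V , V⊆U) o)    v       = let C , f = power-box o (V⊆U v) in C , (λ c → U⊆V (f c))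
    power-box whole                  _       = box-⊤ , (λ _ → tt)
    power-box (inter o o′)           (u , v) =
      let C , f = power-box o u ; D , g = power-box o′ v in
      box-∩ C D , (λ (w , ws) → f (proj₁ w , proj₁ ∘ ws) , g (proj₂ w , proj₂ ∘ ws))
    power-box (union I U os)         (i , u) = let C , f = power-box (os i) u in C , (λ c → i , f c)

    -- Induction on the generation of `W`: subbasic sets of `Z` give boxes directly, those of the
    -- power are handled by `power-box`, and boxes around the same point can be intersected.
    open⇒box : ∀ {z xs W} → (Z ×ₜ (X ^ₜ n)) .Open W → (z , xs) ∈ W → BoxNeighbourhood W z xs
    open⇒box (basic (left {U} o))   u       =
      record box-⊤ { base = U ; base-open = o ; z∈base = u } , proj₁
    open⇒box (basic (right o))      v       = power-box o v
    open⇒box (ext (U⊆V , V⊆U) o)    v       = let C , f = open⇒box o (V⊆U v) in C , (λ c → U⊆V (f c))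
    open⇒box whole                  _       = box-⊤ , (λ _ → tt)
    open⇒box (inter o o′)           (u , v) =
      let C , f = open⇒box o u ; D , g = open⇒box o′ v in
      box-∩ C D , (λ (w , ws) → f (proj₁ w , proj₁ ∘ ws) , g (proj₂ w , proj₂ ∘ ws))
    open⇒box (union I U os)         (i , u) = let C , f = open⇒box (os i) u in C , (λ c → i , f c)

  -- Sides of a box are saturated one coordinate at a time, by the tube lemma for the fibre of the
  -- quotient map over that coordinate.
  module _ (Z X : TopologicalSpace ℓ) (_~_ : Rel ∣ X ∣ ℓ) (~-isEquivalence : IsEquivalence _~_)
           (≈⇒~ : TopologicalSpace._≈_ X ⇒ _~_) (compact : TopologicalSpace.Compact X)
           (separate : TotallySeparated (Quotient.space X _~_ ~-isEquivalence ≈⇒~)) where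
    open Box
    private
      module X = TopologicalSpace X
      X/~ : TopologicalSpace ℓ
      X/~ = Quotient.space X _~_ ~-isEquivalence ≈⇒~
      module X/~ = TopologicalSpace X/~

    module _ {n : ℕ} {W : Pred (∣ Z ∣ × (Fin n → ∣ X ∣)) ℓ} (W-open : (Z ×ₜ (X ^ₜ n)) .Open W)
             (W-saturated : ∀ {z xs} → (z , xs) ∈ W → ∀ k {y} → xs k ~ y → (z , xs [ k ≔ y ]) ∈ W) where

      saturated-box : ∀ (ks : List (Fin n)) {z xs} → (z , xs) ∈ W →
        Σ[ C ∈ Box Z X z xs ] Inside C ⊆ W × (∀ k → k ∈ₗ ks → side C k Respects _~_)
      saturated-box []       w = let C , f = open⇒box Z X W-open w in C , f , (λ _ ())
      saturated-box (k ∷ ks) {z} {xs} w =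
        let C , resp , f = compact-induction X compact P
              (λ empty → box-⊤ , (λ _ _ _ _ → tt) , (λ _ u → contradiction u (empty _)))
              (λ (C , resp , f) (D , resp′ , g) → box-∩ C D ,
                 (λ j j∈ x~y (c , d) → resp j j∈ x~y c , resp′ j j∈ x~y d) ,
                 (λ (w , ws) → [ f (proj₁ w , proj₁ ∘ ws) , g (proj₂ w , proj₂ ∘ ws) ]))
              (λ N⊆N′ (C , resp , f) → C , resp , (λ c u → f c (N⊆N′ u)))
              local
        in C , (λ c → f c tt) , resp
        where
        P : Pred (Pred ∣ X ∣ ℓ) (lsuc ℓ)
        -- `N` restricts only the coordinate `k`. Once `N` is the whole space, the box itself lies
        -- in `W`.
        P N = Σ[ C ∈ Box Z X z xs ] (∀ j → j ∈ₗ k ∷ ks → side C j Respects _~_) ×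
              (∀ {w ys} → (w , ys) ∈ Inside C → ys k ∈ N → (w , ys) ∈ W)

        local : ∀ y → Σ[ N ∈ Pred ∣ X ∣ ℓ ] X.Open N × y ∈ N × P N
        local y with em {P = xs k ~ y}
        ... | no xk≁y =
          -- Values outside the class of `xs k` are excluded by the box: its side at `k` is the
          -- saturated set `M`, so nothing remains to be shown on `∁ M`.
          let M , ((resp , o) , _ , _ , o′) , xk∈M , y∉M = separate xk≁y in
          ∁ M , o′ , y∉M , box-cylinder Z X k o xk∈M ,
          (λ _ _ x~y m j≡k → resp x~y (m j≡k)) , (λ (_ , ms) ¬m → contradiction (ms k refl) ¬m)
        ... | yes xk~y =
          -- Saturation of `W` allows the recursive call at the tuple with `y` in place `k`. The
          -- side at `k` of the resulting box serves as `N`; the new box drops that side, hence is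
          -- trivially saturated at `k`.
          let C , f , resp = saturated-box ks (W-saturated w k xk~y) in
          side C k , side-open C k ,
          subst (side C k) (updateAt-updates k xs) (xs∈side C k) ,
          record
            { base      = base C
            ; side      = λ j x → j ≢ k → x ∈ side C j
            ; base-open = base-open C
            ; side-open = λ j → open-→ X (j ≢ k) (side-open C j)
            ; z∈base    = z∈base C
            ; xs∈side   = λ j j≢k → subst (side C j) (updateAt-minimal j k xs j≢k) (xs∈side C j)
            } ,
          (λ { j (here j≡k)   _   _ j≢k → contradiction j≡k j≢k
             ; j (there j∈ks) x~y c j≢k → resp j j∈ks x~y (c j≢k) }) ,
          (λ {w} {ys} (b , cs) ck → f (b , sides C ys cs ck))
          where
          sides : ∀ {y} (C : Box Z X z (xs [ k ≔ y ])) ys → (∀ j → j ≢ k → ys j ∈ side C j) →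
                  ys k ∈ side C k → ∀ j → ys j ∈ side C j
          sides C ys cs ck j with j ≟ k
          ... | yes refl = ck
          ... | no j≢k   = cs j j≢k

      -- A product of quotient maps need not be a quotient map; compactness and separation give what
      -- is required to make operations on `X/~` continuous. Taking all coordinates in
      -- `saturated-box` makes every side open in `X/~`.
      saturated-open : (Z ×ₜ (X/~ ^ₜ n)) .Open W
      saturated-open = open-locally (Z ×ₜ (X/~ ^ₜ n)) λ w →
        let C , C⊆W , resp = saturated-box (allFin n) w
            C/~ = record
              { base      = base C
              ; side      = side C
              ; base-open = base-open C
              ; side-open = λ i → (λ {x} {y} → resp i (∈-allFin i) {x} {y}) , side-open C i
              ; z∈base    = z∈base C
              ; xs∈side   = xs∈side C
              }
        in Inside C , inside-open {X = X/~} C/~ , (z∈base C , xs∈side C) , C⊆W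

-- Syntactic congruences

module Syntactic {Ω : StoneSignature ℓ} (A : TopologicalAlgebra Ω) where
  open StoneSignature Ω
  open TopologicalAlgebra A hiding (Open; IsStone)
    renaming (refl to ≈-refl; sym to ≈-sym; trans to ≈-trans)
  private module A = TopologicalAlgebra A

  ⟦⟧-cong : (ω : ∣ Op n ∣) {xs ys : Fin n → Carrier} → (∀ i → xs i ≈ ys i) → ⟦ ω ⟧ xs ≈ ⟦ ω ⟧ ys
  ⟦⟧-cong {n} ω xs≈ys = ContinuousMap.cong (eval n) (TopologicalSpace.refl (Op n) , xs≈ys)

  -- Contexts are read from the hole outwards.
  data Context : Set ℓ where
    □     : Context
    apply : ∀ {n} → ∣ Op n ∣ → Fin n → (Fin n → Carrier) → Context → Context

  plug : Context → Carrier → Carrier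
  plug □                x = x
  plug (apply ω i xs c) x = plug c (⟦ ω ⟧ (xs [ i ≔ x ]))

  plug-cong : ∀ c {x y} → x ≈ y → plug c x ≈ plug c y
  plug-cong □                x≈y = x≈y
  plug-cong (apply ω i xs c) x≈y =
    plug-cong c (⟦⟧-cong ω (≔-pointwise _≈_ x≈y (λ _ _ → ≈-refl)))

  ≔-continuous : (xs : Fin n → Carrier) (i : Fin n) → ∀ {V} → (space ^ₜ n) .Open V →
                 A.Open (λ x → xs [ i ≔ x ] ∈ V)
  ≔-continuous {n} xs i = generated-preimage space (TopologicalSpace.setoid (space ^ₜ n)) _ subbasic
    where
    subbasic : ∀ {V} → ∏-Subbasis (λ _ → space) V → A.Open (λ x → xs [ i ≔ x ] ∈ V)
    subbasic (cylinder j {V} o) with j ≟ i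
    ... | yes refl = open-≐ (subst V (sym (updateAt-updates j xs)) , subst V (updateAt-updates j xs)) o
    ... | no j≢i   = open-≐ (subst V (sym (updateAt-minimal j i xs j≢i)) ,
                             subst V (updateAt-minimal j i xs j≢i))
                       (open-const space (V (xs j)))

  plug-continuous : ∀ c {V} → A.Open V → A.Open (plug c ⊢ V)
  plug-continuous □                    o = o
  plug-continuous (apply {n} ω i xs c) o =
    generated-preimage space (TopologicalSpace.setoid (Op n ×ₜ (space ^ₜ n))) (λ x → ω , xs [ i ≔ x ])
      (λ { (left {U} _) → open-const space (ω ∈ U) ; (right o′) → ≔-continuous xs i o′ })
      (ContinuousMap.continuous (eval n) (plug-continuous c o))

  module Congruence (K : Pred Carrier ℓ) (K-respects : K Respects _≈_) where

    _~_ : Rel Carrier ℓ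
    x ~ y = ∀ c → K (plug c x) ⇔ K (plug c y)

    private module ⇔ = IsEquivalence (⇔-isEquivalence {ℓ})

    ~-isEquivalence : IsEquivalence _~_
    ~-isEquivalence = record
      { refl  = λ c → ⇔.refl
      ; sym   = λ x~y c → ⇔.sym (x~y c)
      ; trans = λ x~y y~z c → ⇔.trans (x~y c) (y~z c)
      }
    open IsEquivalence ~-isEquivalence public
      using () renaming (refl to ~-refl; sym to ~-sym; trans to ~-trans)

    ≈⇒~ : _≈_ ⇒ _~_
    ≈⇒~ x≈y c = mk⇔ (K-respects (plug-cong c x≈y)) (K-respects (plug-cong c (≈-sym x≈y)))

    -- A context `c` around the operation is the context `apply ω k xs c` around its argument at
    -- `k`. The first link rewrites `xs` as its own update by `xs k`.
    ⟦⟧-update : (ω : ∣ Op n ∣) (xs : Fin n → Carrier) (k : Fin n) {y : Carrier} →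
                xs k ~ y → ⟦ ω ⟧ xs ~ ⟦ ω ⟧ (xs [ k ≔ y ])
    ⟦⟧-update ω xs k xk~y = ~-trans
      (≈⇒~ (⟦⟧-cong ω (≔-elim (λ j x → xs j ≈ x) ≈-refl (λ _ _ → ≈-refl))))
      (λ c → xk~y (apply ω k xs c))

    -- The arguments are exchanged one at a time; `ks` lists the positions where the tuples may
    -- still differ.
    ⟦⟧-cong-on : (ω : ∣ Op n ∣) (ks : List (Fin n)) {xs ys : Fin n → Carrier} →
                 (∀ i → xs i ~ ys i) → (∀ i → i ∉ₗ ks → xs i ≈ ys i) → ⟦ ω ⟧ xs ~ ⟦ ω ⟧ ys
    ⟦⟧-cong-on ω []       xs~ys xs≈ys = ≈⇒~ (⟦⟧-cong ω (λ i → xs≈ys i (λ ())))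
    ⟦⟧-cong-on ω (k ∷ ks) {xs} {ys} xs~ys xs≈ys = ~-trans (⟦⟧-update ω xs k (xs~ys k))
      (⟦⟧-cong-on ω ks
        (≔-elim (λ j x → x ~ ys j) ~-refl (λ j _ → xs~ys j))
        (≔-elim (λ j x → j ∉ₗ ks → x ≈ ys j) (λ _ → ≈-refl)
          (λ j j≢k j∉ks → xs≈ys j (λ { (here j≡k) → j≢k j≡k ; (there j∈ks) → j∉ks j∈ks }))))

    ⟦⟧-cong-~ : {ω ω′ : ∣ Op n ∣} → TopologicalSpace._≈_ (Op n) ω ω′ →
                {xs ys : Fin n → Carrier} → (∀ i → xs i ~ ys i) → ⟦ ω ⟧ xs ~ ⟦ ω′ ⟧ ys
    ⟦⟧-cong-~ {n} {ω} {ω′} ω≈ω′ xs~ys = ~-trans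
      (⟦⟧-cong-on ω (allFin n) xs~ys (λ i i∉ → contradiction (∈-allFin i) i∉))
      (≈⇒~ (ContinuousMap.cong (eval n) (ω≈ω′ , λ _ → ≈-refl)))

-- The quotient algebra of a syntactic congruence.

module SyntacticQuotient (em : ∀ {a} → ExcludedMiddle a) {Ω : StoneSignature ℓ}
                         (A : TopologicalAlgebra Ω) (compact : TopologicalAlgebra.Compact A)
                         {K : Pred (TopologicalAlgebra.Carrier A) ℓ}
                         (K-clopen : TopologicalAlgebra.Clopen A K) where
  open StoneSignature Ω
  open Classical em
  open TopologicalAlgebra A using (space; eval)
  open Syntactic A public
  open Congruence K (proj₁ (proj₂ K-clopen)) public

  private
    module A/~ = Quotient space _~_ ~-isEquivalence ≈⇒~

  plug⁻¹-clopen : ∀ c → TopologicalSpace.Clopen A/~.space (plug c ⊢ K)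
  plug⁻¹-clopen c =
    (resp , plug-continuous c (proj₁ K-clopen)) , resp ,
    (λ x~y ¬k k → ¬k (Equivalence.from (x~y c) k)) , plug-continuous c (proj₂ (proj₂ K-clopen))
    where
    resp : (plug c ⊢ K) Respects _~_
    resp x~y = Equivalence.to (x~y c)

  separate : TotallySeparated A/~.space
  separate {x} {y} x≁y = dne λ none → x≁y λ c → mk⇔
    (λ k → dne λ ¬k′ → none (plug c ⊢ K , plug⁻¹-clopen c , k , ¬k′))
    -- If the context sends only `y` into `K`, the complement is the clopen set containing `x`.
    (λ k′ → dne λ ¬k → none (∁ (plug c ⊢ K) , clopen-∁ A/~.space (plug⁻¹-clopen c) , ¬k , λ ¬k′ → ¬k′ k′))

  quotient : TopologicalAlgebra Ω
  quotient = record
    { space = A/~.space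
    ; eval  = λ n → record
      { func       = record
        { to   = ContinuousMap.to (eval n)
        ; cong = λ (ω≈ω′ , xs~ys) → ⟦⟧-cong-~ ω≈ω′ xs~ys
        }
      ; continuous = λ (resp , o) →
          -- The preimage of a saturated open set under the operation is saturated in each argument
          -- by `⟦⟧-update`.
          saturated-open (Op n) space _~_ ~-isEquivalence ≈⇒~ compact separate
            (ContinuousMap.continuous (eval n) o)
            (λ {ω} {xs} u k xk~y → resp (⟦⟧-update ω xs k xk~y) u)
      }
    }

  quotient-stone : IsStoneAlgebra quotient
  quotient-stone = totallySeparated⇒stone A/~.space (A/~.compact compact) separate

  projection : ContinuousHom A quotient
  projection = record { map = A/~.projection ; homo = λ _ _ → ~-refl }

-- Maps into finite products and recognition of clopen sets.

module _ {Ω : StoneSignature ℓ} {m : ℕ} {A : TopologicalAlgebra Ω}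
         {B : Fin m → TopologicalAlgebra Ω} where

  tuple : (∀ i → ContinuousHom A (B i)) → ContinuousHom A (∏ₐ B)
  tuple f = record
    { map  = record
      { func       = record { to = λ x i → f.to i x ; cong = λ x≈y i → f.cong i x≈y }
      ; continuous = generated-preimage A.space (TopologicalAlgebra.setoid (∏ₐ B)) _
                       (λ { (cylinder i o) → f.continuous i o })
      }
    ; homo = λ ω xs i → f.homo i ω xs
    }
    where
    module A = TopologicalAlgebra A
    module f i = ContinuousHom (f i)

module _ (em : ∀ {a} → ExcludedMiddle a) {Ω : StoneSignature ℓ}
         {𝒮 : Pred (TopologicalAlgebra Ω) p} (pseudovariety : IsStonePseudovariety 𝒮) where
  open StoneSignature Ω
  open IsStonePseudovariety pseudovariety
  open Classical em

  module _ (S : TopologicalAlgebra Ω) (S-compact : TopologicalAlgebra.Compact S)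
           (residual : Residually 𝒮 S) where
    private module S = TopologicalAlgebra S

    Quotients : Set _
    Quotients = List (Σ[ B ∈ TopologicalAlgebra Ω ] B ∈ 𝒮 × ContinuousHom S B)

    Distinguish : Quotients → S.Carrier → S.Carrier → Set _
    Distinguish fs x y = Any
      (λ (B , _ , f) → ¬ TopologicalAlgebra._≈_ B (ContinuousHom.to f x) (ContinuousHom.to f y)) fs

    module _ {L : Pred S.Carrier ℓ} (L-clopen : S.Clopen L) where

      -- First of two uses of compactness: `x` is fixed while `y` varies. Disjoint neighbourhoods of
      -- two distinct images pull back to `S`, so one homomorphism distinguishes all pairs near `x`
      -- and `y`.
      distinguish-near : ∀ {x} → x ∈ L → Σ[ fs ∈ Quotients ] Σ[ U ∈ Pred S.Carrier ℓ ]
        S.Open U × x ∈ U × (∀ {x′ y} → x′ ∈ U → y ∉ L → Distinguish fs x′ y)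
      distinguish-near {x} x∈L =
        let fs , U , o , x∈U , d = compact-induction S.space S-compact P
              (λ empty → [] , _ , S.open-⊤ , tt , (λ _ _ u → contradiction u (empty _)))
              (λ (fs , U , o , x∈U , d) (fs′ , U′ , o′ , x∈U′ , d′) →
                 fs ++ fs′ , U ∩ U′ , S.open-∩ o o′ , (x∈U , x∈U′) ,
                 (λ (u , u′) y∉L → [ (λ n → ++⁺ˡ (d u y∉L n)) , (λ n → ++⁺ʳ fs (d′ u′ y∉L n)) ]))
              (λ N⊆N′ (fs , U , o , x∈U , d) → fs , U , o , x∈U , (λ u y∉L n → d u y∉L (N⊆N′ n)))
              local
        in fs , U , o , x∈U , (λ u y∉L → d u y∉L tt)
        where
        P : Pred (Pred S.Carrier ℓ) _
        P N = Σ[ fs ∈ Quotients ] Σ[ U ∈ Pred S.Carrier ℓ ]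
          S.Open U × x ∈ U × (∀ {x′ y} → x′ ∈ U → y ∉ L → y ∈ N → Distinguish fs x′ y)

        local : ∀ y → Σ[ N ∈ Pred S.Carrier ℓ ] S.Open N × y ∈ N × P N
        local y with em {P = y ∈ L}
        ... | yes y∈L = L , proj₁ L-clopen , y∈L , [] , _ , S.open-⊤ , tt ,
                        (λ _ y∉L y∈L → contradiction y∈L y∉L)
        ... | no y∉L  =
          let B , B∈𝒮 , f , fx≉fy = residual (λ x≈y → y∉L (proj₁ (proj₂ L-clopen) x≈y x∈L))
              open ContinuousHom f using (to; continuous)
              U , V , oU , oV , fx∈U , fy∈V , disjoint = IsStone.hausdorff (stone B∈𝒮) fx≉fy
          in to ⊢ V , continuous oV , fy∈V , (B , B∈𝒮 , f) ∷ [] , to ⊢ U , continuous oU , fx∈U ,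
             (λ u _ v → here λ e → disjoint _
               (u , TopologicalAlgebra.open-respects B oV (TopologicalAlgebra.sym B e) v))

      -- The second use of compactness: `x` now varies over `L`, and the finite families found near
      -- each point are concatenated.
      distinguish : Σ[ fs ∈ Quotients ] (∀ {x y} → x ∈ L → y ∉ L → Distinguish fs x y)
      distinguish =
        let fs , d = compact-induction S.space S-compact P
              (λ empty → [] , (λ u → contradiction u (empty _)))
              (λ (fs , d) (fs′ , d′) → fs ++ fs′ ,
                 (λ n x∈L y∉L → [ (λ u → ++⁺ˡ (d u x∈L y∉L)) , (λ u → ++⁺ʳ fs (d′ u x∈L y∉L)) ] n))
              (λ N⊆N′ (fs , d) → fs , (λ n → d (N⊆N′ n)))
              local
        in fs , d tt
        where
        P : Pred (Pred S.Carrier ℓ) _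
        P N = Σ[ fs ∈ Quotients ] (∀ {x y} → x ∈ N → x ∈ L → y ∉ L → Distinguish fs x y)

        local : ∀ x → Σ[ N ∈ Pred S.Carrier ℓ ] S.Open N × x ∈ N × P N
        local x with em {P = x ∈ L}
        ... | no x∉L  = ∁ L , proj₂ (proj₂ L-clopen) , x∉L , [] ,
                        (λ x∉L x∈L → contradiction x∈L x∉L)
        ... | yes x∈L = let fs , U , o , x∈U , d = distinguish-near x∈L in
                        U , o , x∈U , fs , (λ u _ → d u)

      -- A clopen set is recognised by a single member of 𝒮: take the product of a finite
      -- distinguishing family.
      recognise : Σ[ F ∈ TopologicalAlgebra Ω ] F ∈ 𝒮 × Σ[ f ∈ ContinuousHom S F ]
        (∀ {x y} → TopologicalAlgebra._≈_ F (ContinuousHom.to f x) (ContinuousHom.to f y) → x ∈ L → y ∈ L)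
      recognise =
        let fs , d = distinguish in
        ∏ₐ (λ i → proj₁ (lookup fs i)) ,
        products _ (λ i → proj₁ (proj₂ (lookup fs i))) ,
        tuple (λ i → proj₂ (proj₂ (lookup fs i))) ,
        -- Equality in the product holds in every factor, including the one whose index is recorded
        -- by `q`.
        (λ e x∈L → dne λ y∉L → let q = d x∈L y∉L in lookup-result q (e (Any.index q)))

  -- The syntactic quotient as an image of a closed subalgebra.

  module _ (S T : TopologicalAlgebra Ω) (S-stone : IsStoneAlgebra S) (T-stone : IsStoneAlgebra T)
           (φ : ContinuousHom S T) (φ-onto : ContinuousHom.Onto φ) (residual : Residually 𝒮 S)
           {K : Pred (TopologicalAlgebra.Carrier T) ℓ} (K-clopen : TopologicalAlgebra.Clopen T K) where
    private
      module S = TopologicalAlgebra S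
      module T = TopologicalAlgebra T
      module φ = ContinuousHom φ
      S-compact : S.Compact
      S-compact = IsStone.compact S-stone
      open SyntacticQuotient em T (IsStone.compact T-stone) K-clopen
      module Q = TopologicalAlgebra quotient

      L-clopen : S.Clopen (φ.to ⊢ K)
      L-clopen = let (o , _ , o′) = K-clopen in
        φ.continuous o , S.open-respects (φ.continuous o) , φ.continuous o′

      recogniser : _
      recogniser = recognise S S-compact residual L-clopen

      F : TopologicalAlgebra Ω
      F = proj₁ recogniser
      F∈𝒮 : F ∈ 𝒮
      F∈𝒮 = proj₁ (proj₂ recogniser)
      module F = TopologicalAlgebra F
      module F-ops = Syntactic F

      f : ContinuousHom S F
      f = proj₁ (proj₂ (proj₂ recogniser))
      module f = ContinuousHom f

      -- Induction on the context. The parameters of the operation next to the hole are lifted along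
      -- `φ`, so this operation is carried out in `S`, where it preserves equality under `f`; the
      -- remaining context is then shorter. The empty context is the recognition property of `f`.
      ker-f : ∀ c {s s′} → f.to s F.≈ f.to s′ → K (plug c (φ.to s)) → K (plug c (φ.to s′))
      ker-f □                e k = proj₂ (proj₂ (proj₂ recogniser)) e k
      ker-f (apply ω i xs c) {s} {s′} e k =
        K-respects (plug-cong c (lift s′))
          (ker-f c f-eq (K-respects (plug-cong c (T.sym (lift s))) k))
        where
        K-respects : K Respects T._≈_
        K-respects = proj₁ (proj₂ K-clopen)

        zs : Fin _ → S.Carrier
        zs j = proj₁ (φ-onto (xs j))

        lift : ∀ s → φ.to (S.⟦ ω ⟧ (zs [ i ≔ s ])) T.≈ T.⟦ ω ⟧ (xs [ i ≔ φ.to s ])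
        lift s = T.trans (φ.homo ω _)
          (⟦⟧-cong ω (≔-pointwise (λ z x → φ.to z T.≈ x) T.refl (λ j _ → proj₂ (φ-onto (xs j)))))

        f-eq : f.to (S.⟦ ω ⟧ (zs [ i ≔ s ])) F.≈ f.to (S.⟦ ω ⟧ (zs [ i ≔ s′ ]))
        f-eq = F.trans (f.homo ω _) (F.trans
          (F-ops.⟦⟧-cong ω (≔-pointwise (λ z z′ → f.to z F.≈ f.to z′) e (λ _ _ → F.refl)))
          (F.sym (f.homo ω _)))

      f≈⇒~ : ∀ {s s′} → f.to s F.≈ f.to s′ → φ.to s ~ φ.to s′
      f≈⇒~ e c = mk⇔ (ker-f c e) (ker-f c (F.sym e))

      f-image-closed : ∀ {D} → S.Open (∁ D) → F.Closed (Image f.map D)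
      f-image-closed = image-closed f.map S-compact (IsStone.hausdorff (stone F∈𝒮))

      Im : Pred F.Carrier ℓ
      Im = Image f.map (λ _ → ⊤)

      Im-subalgebra : IsClosedSubalgebra F Im
      Im-subalgebra = record
        { closed      = f-image-closed (proj₂ (proj₂ (clopen-⊤ S.space)))
        ; closed-eval = λ ω bs → S.⟦ ω ⟧ (proj₁ ∘ bs) , tt ,
            F.trans (f.homo ω _) (F-ops.⟦⟧-cong ω (λ i → proj₂ (proj₂ (bs i))))
        }

      -- Each point of `Im` carries a preimage `s` under `f`; the class of `φ s` does not depend on
      -- it by `f≈⇒~`.
      image→quotient : ContinuousHom (subalgebra F Im Im-subalgebra) quotient
      image→quotient = record
        { map  = record
          { func       = record
            { to   = λ (_ , s , _) → φ.to s
            ; cong = λ { {_ , s , _ , e} {_ , s′ , _ , e′} b≈b′ →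
                         f≈⇒~ (F.trans e (F.trans b≈b′ (F.sym e′))) }
            }
          ; continuous = preimage
          }
        -- The preimage supplied by `closed-eval` is the operation applied in `S` to the given
        -- preimages.
        ; homo = λ ω bs → ≈⇒~ (φ.homo ω _)
        }
        where
        preimage : ∀ {U} → Q.Open U →
                   TopologicalSpace.Open (subspace F.space Im) (λ (_ , s , _) → φ.to s ∈ U)
        preimage {U} (resp , o) =
          -- The points of `F` not hit by `f` from outside the preimage of `U` form an open set, as
          -- `f` is a closed map. Saturation of `U` makes its trace on `Im` the required preimage.
          ∁ (Image f.map (∁ (φ.to ⊢ U))) ,
          proj₂ (f-image-closed (S.open-≐ ((λ u ¬u → ¬u u) , dne) (φ.continuous o))) ,
          (λ { {_ , s , _ , e} none → dne (λ ¬u → none (s , ¬u , e)) }) ,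
          (λ { {_ , s , _ , e} u (s′ , ¬u , e′) → ¬u (resp (f≈⇒~ (F.trans e (F.sym e′))) u) })

    quotient∈𝒮 : quotient ∈ 𝒮
    quotient∈𝒮 = images (subalgebras F∈𝒮 Im Im-subalgebra) quotient-stone image→quotient
      (λ t → let s , φs≈t = φ-onto t in (f.to s , s , tt , F.refl) , ≈⇒~ φs≈t)

theorem5p12 : (∀ {a} → ExcludedMiddle a) →
    ∀ {ℓ p : Level} (Ω : StoneSignature ℓ)
    (𝒮 : Pred (TopologicalAlgebra Ω) p) → IsStonePseudovariety 𝒮 →
    (S T : TopologicalAlgebra Ω) → IsStoneAlgebra S → IsStoneAlgebra T →
    (φ : ContinuousHom S T) → ContinuousHom.Onto φ →
    Residually 𝒮 S → Residually 𝒮 T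
theorem5p12 em Ω 𝒮 pseudovariety S T S-stone T-stone φ φ-onto residual x≉y =
  let U , V , oU , _ , x∈U , y∈V , disjoint = IsStone.hausdorff T-stone x≉y
      K , K-clopen , x∈K , K⊆U = IsStone.zeroDimensional T-stone oU x∈U
      open SyntacticQuotient em T (IsStone.compact T-stone) K-clopen
  in quotient ,
     quotient∈𝒮 em pseudovariety S T S-stone T-stone φ φ-onto residual K-clopen ,
     projection ,
     -- The empty context would carry `y` into `K`, hence into `U`, which is disjoint from `V`.
     (λ x~y → disjoint _ (K⊆U (Equivalence.to (x~y □) x∈K) , y∈V))
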